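{- Let $Q=T[H_1,\dots,H_t]$ be a semicomplete composition. Then $Q$ contains an acyclic spanning subdigraph $R$ with a source $x$ and a sink $y$ such that for each vertex $z$ of $Q$, $R$ contains an $x$--$z$ path and a $z$--$y$ path, if one of the following assertions holds: (a) $Q$ is non-strong and has both in- and out-branchings (i.e., at least one in-branching and at least one out-branching); (b) $Q$ is strong with $|V(H_i)|\ge 2$ for each $i\in\{1,\dots,t\}$.
   Context: Digraphs are finite, without loops or parallel arcs (2-cycles are allowed); paths and cycles are directed, and a single vertex is a (trivial) path. A digraph is semicomplete if there is at least one arc between every pair of distinct vertices. Let $T$ be a digraph with vertices $u_1,\dots,u_t$ ($t\ge 2$) and let $H_1,\dots,H_t$ be pairwise disjoint nonempty digraphs. The composition $Q=T[H_1,\dots,H_t]$ is the digraph with vertex set $\bigcup_i V(H_i)$ and arc set $\bigcup_{i=1}^t A(H_i)\cup\{xy : x\in V(H_i),\ y\in V(H_p),\ u_iu_p\in A(T)\}$. It is a semicomplete composition if $T$ is semicomplete. A digraph is strong if for every ordered pair of vertices $(x,y)$ there is a directed path from $x$ to $y$. A digraph is acyclic if it has no directed cycle (including 2-cycles). A source (resp. sink) is a vertex of in-degree zero (resp. out-degree zero). An out-tree (resp. in-tree) rooted at $r$ is an orientation of a tree in which every vertex except $r$ has in-degree (resp. out-degree) one. An out-branching (resp. in-branching) of $D$ is a spanning subdigraph of $D$ which is an out-tree (resp. in-tree). -}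

module Defs where

open import Data.Fin.Base using (Fin; zero; suc)
open import Data.Fin.Properties using (+↔⊎; inj⇒≟)
open import Data.List.Base using (List; []; _∷_; length; filter; tabulate)
open import Data.List.Relation.Unary.Unique.Propositional using (Unique)
open import Data.Nat.Base using (ℕ; zero; suc; _+_; _≤_)
open import Data.Product.Base using (Σ; Σ-syntax; ∃-syntax; _×_; _,_; proj₁)
open import Data.Product.Function.Dependent.Propositional using (Σ-↔)
open import Data.Sum.Base using (_⊎_; inj₁; inj₂)
open import Data.Sum.Function.Propositional using (_⊎-↔_)
open import Data.Vec.Functional using (foldr)
open import Function.Base using (_∘_)
open import Function.Bundles using (_↔_; Inverse; mk↔ₛ′)
open import Function.Construct.Identity using (↔-id)
open import Function.Construct.Composition using (_↔-∘_)
open import Function.Construct.Symmetry using (↔-sym)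
open import Function.Properties.Inverse using (↔⇒↣)
open import Level using (0ℓ)
open import Relation.Binary.Construct.Closure.ReflexiveTransitive using (Star; ε; _◅_)
open import Relation.Binary.Construct.Closure.Symmetric using (SymClosure)
open import Relation.Binary.Core using (Rel)
open import Relation.Binary.Definitions using (Decidable; DecidableEquality)
open import Relation.Binary.PropositionalEquality using (_≡_; _≢_; refl)
open import Relation.Nullary using (¬_; yes; no)

-- Arcs form a relation, so there are no parallel arcs. Decidability of
-- adjacency is what makes the arc set, and not only the vertex set, finite
-- constructively.
record Digraph : Set₁ where
  field
    V       : Set
    order   : ℕ
    enum    : V ↔ Fin order
    Arc     : Rel V 0ℓ
    arc?    : Decidable Arc
    no-loop : ∀ {x} → ¬ Arc x x

  _≟V_ : DecidableEquality V
  _≟V_ = inj⇒≟ (↔⇒↣ enum)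

  vertices : List V
  vertices = tabulate (Inverse.from enum)

  inDegree outDegree : V → ℕ
  inDegree  x = length (filter (λ w → arc? w x) vertices)
  outDegree x = length (filter (λ w → arc? x w) vertices)

  IsSource IsSink : V → Set
  IsSource x = inDegree x ≡ 0
  IsSink   x = outDegree x ≡ 0

open Digraph public using (V; order; Arc)

-- Paths and cycles in an arbitrary relation, used both for the arcs of a
-- digraph and for the edges of its underlying undirected graph.
module _ {A : Set} {_⟶_ : Rel A 0ℓ} where

  walkVertices : ∀ {x y} → Star _⟶_ x y → List A
  walkVertices {x} ε       = x ∷ []
  walkVertices {x} (_ ◅ w) = x ∷ walkVertices w

Path : {A : Set} → Rel A 0ℓ → Rel A 0ℓ
Path _⟶_ x y = Σ[ w ∈ Star _⟶_ x y ] Unique (walkVertices w)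

-- A cycle with at least k vertices: a path x … y closed up by a step y ⟶ x.
Cycle : {A : Set} → ℕ → Rel A 0ℓ → Set
Cycle k _⟶_ =
  ∃[ x ] ∃[ y ] Σ[ p ∈ Path _⟶_ x y ] (k ≤ length (walkVertices (proj₁ p)) × y ⟶ x)

Semicomplete : Digraph → Set
Semicomplete D = ∀ (x y : V D) → x ≢ y → Arc D x y ⊎ Arc D y x

Strong : Digraph → Set
Strong D = ∀ (x y : V D) → Path (Arc D) x y

Acyclic : Digraph → Set
Acyclic D = ¬ Cycle 2 (Arc D)

record SpanningSubdigraph (D : Digraph) : Set₁ where
  field
    SubArc  : Rel (V D) 0ℓ
    subArc? : Decidable SubArc
    subArc⊆ : ∀ {x y} → SubArc x y → Arc D x y

  digraph : Digraph
  digraph = record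
    { V       = V D
    ; order   = order D
    ; enum    = Digraph.enum D
    ; Arc     = SubArc
    ; arc?    = subArc?
    ; no-loop = λ a → Digraph.no-loop D (subArc⊆ a)
    }

-- Edges of the underlying undirected graph.
Edge : (D : Digraph) → Rel (V D) 0ℓ
Edge D = SymClosure (Arc D)

record IsOrientedTree (D : Digraph) : Set where
  field
    oriented  : ∀ {x y : V D} → Arc D x y → ¬ Arc D y x
    connected : ∀ (x y : V D) → Path (Edge D) x y
    noCycle   : ¬ Cycle 3 (Edge D)

IsOutTree IsInTree : (D : Digraph) → V D → Set
IsOutTree D r = IsOrientedTree D × (∀ v → v ≢ r → Digraph.inDegree D v ≡ 1)
IsInTree  D r = IsOrientedTree D × (∀ v → v ≢ r → Digraph.outDegree D v ≡ 1)

HasOutBranching HasInBranching : Digraph → Set₁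
HasOutBranching D =
  Σ[ B ∈ SpanningSubdigraph D ] ∃[ r ] IsOutTree (SpanningSubdigraph.digraph B) r
HasInBranching D =
  Σ[ B ∈ SpanningSubdigraph D ] ∃[ r ] IsInTree (SpanningSubdigraph.digraph B) r

Σ-Fin↔ : ∀ {n} (f : Fin n → ℕ) → Σ (Fin n) (Fin ∘ f) ↔ Fin (foldr _+_ 0 f)
Σ-Fin↔ {zero}  f = mk↔ₛ′ (λ { (() , _) }) (λ ()) (λ ()) (λ { (() , _) })
Σ-Fin↔ {suc n} f = ↔-sym +↔⊎ ↔-∘ ((↔-id _ ⊎-↔ Σ-Fin↔ (f ∘ suc)) ↔-∘ split)
  where
  split : Σ (Fin (suc n)) (Fin ∘ f) ↔ (Fin (f zero) ⊎ Σ (Fin n) (Fin ∘ f ∘ suc))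
  split = mk↔ₛ′
    (λ { (zero , k) → inj₁ k ; (suc i , k) → inj₂ (i , k) })
    (λ { (inj₁ k) → zero , k ; (inj₂ (i , k)) → suc i , k })
    (λ { (inj₁ _) → refl ; (inj₂ _) → refl })
    (λ { (zero , _) → refl ; (suc _ , _) → refl })

-- T[H₁,…,H_t], with the H_i indexed by the vertices of T. The Σ-type makes
-- their vertex sets disjoint.
module Composition (T : Digraph) (H : V T → Digraph) where

  CompV : Set
  CompV = Σ (V T) (λ i → V (H i))

  data CompArc : Rel CompV 0ℓ where
    inner : ∀ {i x y} → Arc (H i) x y → CompArc (i , x) (i , y)
    outer : ∀ {i p x y} → Arc T i p → CompArc (i , x) (p , y)

  compArc? : Decidable CompArc
  compArc? (i , x) (p , y) with Digraph.arc? T i p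
  ... | yes a = yes (outer a)
  ... | no ¬a with Digraph._≟V_ T i p
  ...   | no i≢p = no λ { (inner _) → i≢p refl ; (outer a) → ¬a a }
  ...   | yes refl with Digraph.arc? (H i) x y
  ...     | yes b = yes (inner b)
  ...     | no ¬b = no λ { (inner b) → ¬b b ; (outer a) → ¬a a }

  compNoLoop : ∀ {v} → ¬ CompArc v v
  compNoLoop {i , _} (inner a) = Digraph.no-loop (H i) a
  compNoLoop         (outer a) = Digraph.no-loop T a

  orders : Fin (order T) → ℕ
  orders j = order (H (Inverse.from (Digraph.enum T) j))

  compEnum : CompV ↔ Fin (foldr _+_ 0 orders)
  compEnum = Σ-Fin↔ orders ↔-∘
    ↔-sym (Σ-↔ (↔-sym (Digraph.enum T)) (λ {j} → ↔-sym (Digraph.enum (H (Inverse.from (Digraph.enum T) j)))))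

  composition : Digraph
  composition = record
    { V       = CompV
    ; order   = foldr _+_ 0 orders
    ; enum    = compEnum
    ; Arc     = CompArc
    ; arc?    = compArc?
    ; no-loop = compNoLoop
    }

open Composition public using (composition)

{-# OPTIONS --safe #-}

-- Suppose V(D) splits into a lower part L, all reachable from r inside L, and an
-- upper part, all reaching s inside it, such that every lower vertex has an
-- upper out-neighbour and every upper vertex a lower in-neighbour.  Order the
-- lower part by distance from r, put the upper part above it, ordered by
-- decreasing distance to s, and keep the arcs of D that ascend: in this acyclic
-- subdigraph every vertex but r has an in-neighbour and every vertex but s an
-- out-neighbour, so following these back or forth must end in r or s.
--
-- In case (a), let r and s be the roots of an out- and an in-branching, in H_p
-- and H_q.  The lower part consists of the H_i with u_i reaching u_p in T.  It
-- does not contain s, since otherwise T and hence Q would be strong.  As T is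
-- semicomplete, the lower part dominates s and r dominates the upper part.
--
-- In case (b), T is strong; the lower part consists of one vertex of each H_i.
module Submission where

open import Defs
open import Data.Bool.Base using (if_then_else_)
open import Data.Fin.Base using (Fin; zero; suc; fromℕ<; punchIn)
open import Data.Fin.Induction using (spo-wellFounded)
open import Data.Fin.Properties using (any?; inj⇒≟; injective⇒≤; punchInᵢ≢i)
open import Data.List.Base using (List; []; _∷_; length; filter; lookup)
open import Data.List.Membership.DecPropositional using (_∈?_)
open import Data.List.Membership.Propositional using (_∈_)
open import Data.List.Membership.Propositional.Properties using (∈-lookup)
open import Data.List.Properties using (filter-none)
open import Data.List.Relation.Unary.All as All using ([]; _∷_)
open import Data.List.Relation.Unary.All.Properties using (all-filter; ¬Any⇒All¬)
open import Data.List.Relation.Unary.AllPairs using ([]; _∷_)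
open import Data.List.Relation.Unary.Any using (here; there)
open import Data.List.Relation.Unary.Unique.Propositional using (Unique)
open import Data.Nat.Base using (ℕ; zero; suc; _≤_; _<_; _>_; z≤n; s≤s)
open import Data.Nat.Properties
  using (_<?_; _>?_; <-isStrictPartialOrder; <⇒≤; ≤-reflexive; ≤-trans)
open import Data.Product.Base using (Σ-syntax; ∃-syntax; _×_; _,_; proj₁; proj₂)
open import Data.Sum.Base using (_⊎_; inj₁; inj₂)
open import Data.Sum.Relation.Binary.LeftOrder
  using (_⊎-<_; ₁∼₁; ₁∼₂; ₂∼₂; ⊎-<-decidable; ⊎-<-isStrictPartialOrder)
open import Data.Sum.Relation.Binary.Pointwise using (Pointwise)
open import Function.Base using (_∘_; _on_; case_of_; flip; id)
open import Function.Bundles using (_↔_; Injection; Inverse)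
open import Function.Properties.Inverse using (↔⇒↣)
open import Induction.WellFounded using (WellFounded; Acc; acc; module Subrelation)
open import Level using (0ℓ)
import Relation.Binary.Construct.Flip.EqAndOrd as Flip
import Relation.Binary.Construct.NonStrictToStrict as ToStrict
import Relation.Binary.Construct.On as On
open import Relation.Binary.Construct.Closure.ReflexiveTransitive as Star using (Star; ε; _◅_; _◅◅_)
open import Relation.Binary.Construct.Closure.ReflexiveTransitive.Properties using (isPreorder)
open import Relation.Binary.Construct.Closure.Symmetric using (fwd)
open import Relation.Binary.Core using (Rel; _⇒_)
open import Relation.Binary.Definitions using (Antisymmetric; Decidable; DecidableEquality)
open import Relation.Binary.PropositionalEquality
  using (_≡_; _≢_; refl; sym; cong; subst; subst₂; ≢-sym)
open import Relation.Binary.Structures using (IsPartialOrder; IsStrictPartialOrder)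
open import Relation.Nullary
  using (¬_; Dec; yes; no; does; ¬?; contradiction; contraposition; _×-dec_)
open import Relation.Nullary.Decidable using (map′; dec-true; dec-false)
open import Relation.Unary as Unary using (∁)

private variable
  A : Set
  n : ℕ

module _ {A : Set} {R : Rel A 0ℓ} where

  path-suffix : ∀ {x y z} (w : Star R x y) → Unique (walkVertices w) →
    z ∈ walkVertices w → Path R z y
  path-suffix ε       w!       (here refl) = ε , w!
  path-suffix (a ◅ w) w!       (here refl) = a ◅ w , w!
  path-suffix (_ ◅ w) (_ ∷ w!) (there z∈w) = path-suffix w w! z∈w

  star⇒path : DecidableEquality A → ∀ {x y} → Star R x y → Path R x y
  star⇒path _≟_     ε       = ε , [] ∷ []
  star⇒path _≟_ {x} (a ◅ w) with star⇒path _≟_ w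
  ... | p , p! with _∈?_ _≟_ x (walkVertices p)
  ...   | yes x∈p = path-suffix p p! x∈p
  ...   | no  x∉p = a ◅ p , ¬Any⇒All¬ _ x∉p ∷ p!

  first-step : ∀ {x y} → Star R x y → x ≢ y → ∃[ z ] R x z
  first-step ε       x≢x = contradiction refl x≢x
  first-step (a ◅ _) _   = _ , a

  2≤∣walkVertices∣ : ∀ {x y} → x ≢ y → (w : Star R x y) → 2 ≤ length (walkVertices w)
  2≤∣walkVertices∣ x≢x ε           = contradiction refl x≢x
  2≤∣walkVertices∣ _   (_ ◅ ε)     = s≤s (s≤s z≤n)
  2≤∣walkVertices∣ _   (_ ◅ _ ◅ _) = s≤s (s≤s z≤n)

  walkVertices-map : ∀ {E : Rel A 0ℓ} (R⇒E : R ⇒ E) {x y} (w : Star R x y) →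
    walkVertices (Star.map {U = E} R⇒E w) ≡ walkVertices w
  walkVertices-map R⇒E ε       = refl
  walkVertices-map R⇒E (_ ◅ w) = cong (_ ∷_) (walkVertices-map R⇒E w)

  wellFounded⇒reachable : DecidableEquality A → WellFounded R → ∀ {r} →
    (∀ z → z ≢ r → ∃[ w ] R w z) → ∀ z → Star R r z
  wellFounded⇒reachable _≟_ wf {r} predecessor z = go z (wf z)
    where
    go : ∀ z → Acc R z → Star R r z
    go z (acc rs) with z ≟ r
    ... | yes refl = ε
    ... | no  z≢r  = let w , a = predecessor z z≢r in go w (rs a) ◅◅ a ◅ ε

_↾_ : Rel A 0ℓ → (A → Set) → Rel A 0ℓ
(R ↾ P) u v = R u v × P u × P v

walk-within-successor-closed : ∀ {R : Rel A 0ℓ} {P : A → Set} → (∀ {u v} → R u v → P u → P v) →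
  ∀ {x y} → P x → Star R x y → Star (R ↾ P) x y
walk-within-successor-closed closed Px ε       = ε
walk-within-successor-closed closed Px (a ◅ w) =
  (a , Px , closed a Px) ◅ walk-within-successor-closed closed (closed a Px) w

walk-within-predecessor-closed : ∀ {R : Rel A 0ℓ} {P : A → Set} → (∀ {u v} → R u v → P v → P u) →
  ∀ {x y} → P y → Star R x y → Star (R ↾ P) x y
walk-within-predecessor-closed closed Py w =
  Star.reverse (λ (a , Pv , Pu) → a , Pu , Pv)
    (walk-within-successor-closed closed Py (Star.reverse id w))

Unique-lookup-injective : {xs : List A} → Unique xs → ∀ {i j} → lookup xs i ≡ lookup xs j → i ≡ j
Unique-lookup-injective (_ ∷ _)    {zero}  {zero}  _ = refl
Unique-lookup-injective (x∉xs ∷ _) {zero}  {suc j} e =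
  contradiction e (All.lookup x∉xs (∈-lookup j))
Unique-lookup-injective (x∉xs ∷ _) {suc i} {zero}  e =
  contradiction (sym e) (All.lookup x∉xs (∈-lookup i))
Unique-lookup-injective (_ ∷ xs!)  {suc i} {suc j} e = cong suc (Unique-lookup-injective xs! e)

module _ (enum : A ↔ Fin n) where

  open Inverse enum using (to; from; inverseˡ; strictlyInverseʳ)

  ∃? : {P : A → Set} → Unary.Decidable P → Dec (∃[ x ] P x)
  ∃? {P} P? = map′ (λ (i , Pi) → from i , Pi)
                   (λ (x , Px) → to x , subst P (sym (strictlyInverseʳ x)) Px)
                   (any? (P? ∘ from))

  Unique⇒length≤ : {xs : List A} → Unique xs → length xs ≤ n
  Unique⇒length≤ xs! = injective⇒≤ λ e →
    Unique-lookup-injective xs! (Injection.injective (↔⇒↣ enum) e)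

  strictPartialOrder-wellFounded : {_≈_ _≺_ : Rel A 0ℓ} →
    IsStrictPartialOrder _≈_ _≺_ → WellFounded _≺_
  strictPartialOrder-wellFounded {_≺_ = _≺_} isSPO =
    Subrelation.wellFounded
      (subst₂ _≺_ (sym (strictlyInverseʳ _)) (sym (strictlyInverseʳ _)))
      (On.wellFounded to (spo-wellFounded (On.isStrictPartialOrder from isSPO)))

element : A ↔ Fin n → 1 ≤ n → A
element enum 1≤n = Inverse.from enum (fromℕ< 1≤n)

another-element : A ↔ Fin n → 2 ≤ n → (x : A) → ∃[ y ] (x ≢ y)
another-element enum (s≤s (s≤s _)) x =
  from (punchIn (to x) zero) , λ e → punchInᵢ≢i (to x) zero (sym (inverseˡ e))
  where open Inverse enum using (to; from; inverseˡ)

-- If no k ≤ n satisfies P, the value is n.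
least≤ : {P : ℕ → Set} → Unary.Decidable P → ℕ → ℕ
least≤ P? zero    = zero
least≤ P? (suc n) = if does (P? 0) then 0 else suc (least≤ (P? ∘ suc) n)

least≤-satisfies : {P : ℕ → Set} (P? : Unary.Decidable P) → ∀ {n k} → P k → k ≤ n → P (least≤ P? n)
least≤-satisfies P? {zero}  Pk z≤n = Pk
least≤-satisfies P? {suc n} Pk k≤n with P? 0
... | yes P0 = P0
least≤-satisfies P? {suc n} P0 z≤n       | no ¬P0 = contradiction P0 ¬P0
least≤-satisfies P? {suc n} Pk (s≤s k≤n) | no ¬P0 = least≤-satisfies (P? ∘ suc) Pk k≤n

least≤-minimal : {P : ℕ → Set} (P? : Unary.Decidable P) → ∀ n {k} → P k → least≤ P? n ≤ k
least≤-minimal P? zero    Pk = z≤n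
least≤-minimal P? (suc n) Pk with P? 0
... | yes _ = z≤n
least≤-minimal P? (suc n) {zero}  P0 | no ¬P0 = contradiction P0 ¬P0
least≤-minimal P? (suc n) {suc k} Pk | no ¬P0 = s≤s (least≤-minimal (P? ∘ suc) n Pk)

module Distance {A : Set} (enum : A ↔ Fin n) {R : Rel A 0ℓ} (R? : Decidable R) where

  _≟_ : DecidableEquality A
  _≟_ = inj⇒≟ (↔⇒↣ enum)

  Walk : ℕ → Rel A 0ℓ
  Walk zero    x y = x ≡ y
  Walk (suc k) x y = ∃[ w ] (R x w × Walk k w y)

  walk? : ∀ k → Decidable (Walk k)
  walk? zero    x y = x ≟ y
  walk? (suc k) x y = ∃? enum λ w → R? x w ×-dec walk? k w y

  walk⇒star : ∀ k {x y} → Walk k x y → Star R x y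
  walk⇒star zero    refl        = ε
  walk⇒star (suc k) (_ , a , w) = a ◅ walk⇒star k w

  star⇒walk : ∀ {x y} (w : Star R x y) → ∃[ k ] (k < length (walkVertices w) × Walk k x y)
  star⇒walk ε       = 0 , s≤s z≤n , refl
  star⇒walk (a ◅ w) = let k , k<∣w∣ , v = star⇒walk w in suc k , s≤s k<∣w∣ , _ , a , v

  distance : A → A → ℕ
  distance x y = least≤ (λ k → walk? k x y) n

  distance-walk : ∀ {x y} → Star R x y → Walk (distance x y) x y
  distance-walk w =
    let p , p!        = star⇒path _≟_ w
        k , k<∣p∣ , v = star⇒walk p
    in least≤-satisfies (λ k → walk? k _ _) v (<⇒≤ (≤-trans k<∣p∣ (Unique⇒length≤ enum p!)))

  star? : Decidable (Star R)
  star? x y = map′ (walk⇒star (distance x y)) distance-walk (walk? (distance x y) x y)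

  distance-decreases : ∀ {x y} → Star R x y → x ≢ y → ∃[ w ] (R x w × distance w y < distance x y)
  distance-decreases {x} {y} x⇝y x≢y with distance x y | distance-walk x⇝y
  ... | zero  | x≡y       = contradiction x≡y x≢y
  ... | suc m | w , a , v = w , a , s≤s (least≤-minimal (λ k → walk? k w y) n v)

filter-some⁻ : ∀ {P : A → Set} (P? : Unary.Decidable P) (xs : List A) →
  0 < length (filter P? xs) → ∃[ x ] P x
filter-some⁻ P? xs nonempty with filter P? xs | all-filter P? xs
filter-some⁻ P? xs ()       | []    | _
...                         | x ∷ _ | Px ∷ _ = x , Px

module _ (D : Digraph) where

  open Digraph D using (_≟V_; enum; arc?; no-loop; vertices; IsSource; IsSink)

  walks⇒strong : (∀ x y → Star (Arc D) x y) → Strong D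
  walks⇒strong reach x y = star⇒path _≟V_ (reach x y)

  strong⇒successor : 2 ≤ order D → Strong D → ∀ x → ∃[ y ] Arc D x y
  strong⇒successor 2≤∣D∣ strong x =
    let y , x≢y = another-element enum 2≤∣D∣ x in first-step (proj₁ (strong x y)) x≢y

  strong⇒predecessor : 2 ≤ order D → Strong D → ∀ x → ∃[ y ] Arc D y x
  strong⇒predecessor 2≤∣D∣ strong x =
    let y , x≢y = another-element enum 2≤∣D∣ x
    in first-step {R = flip (Arc D)} (Star.reverse id (proj₁ (strong y x))) x≢y

  orientedTree⇒acyclic : IsOrientedTree D → Acyclic D
  orientedTree⇒acyclic tree (_ , _ , (w , w!) , 2≤∣w∣ , a) =
    noCycle
      ( _ , _ , (Star.map fwd w , subst Unique (sym same-vertices) w!)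
      , subst (λ vs → 3 ≤ length vs) (sym same-vertices) (3≤∣w∣ w 2≤∣w∣ a)
      , fwd a )
    where
    open IsOrientedTree tree using (oriented; noCycle)

    same-vertices : walkVertices (Star.map {U = Edge D} fwd w) ≡ walkVertices w
    same-vertices = walkVertices-map fwd w

    3≤∣w∣ : ∀ {x y} (w : Star (Arc D) x y) → 2 ≤ length (walkVertices w) → Arc D y x →
      3 ≤ length (walkVertices w)
    3≤∣w∣ ε               (s≤s ()) _
    3≤∣w∣ (b ◅ ε)         _        a = contradiction a (oriented b)
    3≤∣w∣ (_ ◅ _ ◅ ε)     _        _ = s≤s (s≤s (s≤s z≤n))
    3≤∣w∣ (_ ◅ _ ◅ _ ◅ _) _        _ = s≤s (s≤s (s≤s z≤n))

  module _ (acyclic : Acyclic D) where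

    acyclic⇒no-return : ∀ {x y} → Arc D x y → ¬ Star (Arc D) y x
    acyclic⇒no-return {x} {y} a y⇝x = acyclic (y , x , p , 2≤∣walkVertices∣ y≢x (proj₁ p) , a)
      where
      p : Path (Arc D) y x
      p = star⇒path _≟V_ y⇝x
      y≢x : y ≢ x
      y≢x refl = no-loop a

    acyclic⇒isPartialOrder : IsPartialOrder _≡_ (Star (Arc D))
    acyclic⇒isPartialOrder = record { isPreorder = isPreorder (Arc D) ; antisym = antisym }
      where
      antisym : Antisymmetric _≡_ (Star (Arc D))
      antisym ε       _ = refl
      antisym (a ◅ v) w = contradiction (v ◅◅ w) (acyclic⇒no-return a)

    private
      StrictlyReaches : Rel (V D) 0ℓ
      StrictlyReaches = ToStrict._<_ _≡_ (Star (Arc D))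

      strictlyReaches-isSPO : IsStrictPartialOrder _≡_ StrictlyReaches
      strictlyReaches-isSPO = ToStrict.<-isStrictPartialOrder _≡_ _ acyclic⇒isPartialOrder

      arc⇒strictlyReaches : Arc D ⇒ StrictlyReaches
      arc⇒strictlyReaches a = a ◅ ε , λ { refl → no-loop a }

    acyclic⇒wellFounded : WellFounded (Arc D)
    acyclic⇒wellFounded = Subrelation.wellFounded arc⇒strictlyReaches
      (strictPartialOrder-wellFounded enum strictlyReaches-isSPO)

    acyclic⇒noetherian : WellFounded (flip (Arc D))
    acyclic⇒noetherian = Subrelation.wellFounded arc⇒strictlyReaches
      (strictPartialOrder-wellFounded enum (Flip.isStrictPartialOrder strictlyReaches-isSPO))

    acyclic∧predecessors⇒reachable : ∀ {r} →
      (∀ z → z ≢ r → ∃[ w ] Arc D w z) → ∀ z → Star (Arc D) r z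
    acyclic∧predecessors⇒reachable = wellFounded⇒reachable _≟V_ acyclic⇒wellFounded

    acyclic∧successors⇒coreachable : ∀ {s} →
      (∀ z → z ≢ s → ∃[ w ] Arc D z w) → ∀ z → Star (Arc D) z s
    acyclic∧successors⇒coreachable successor z =
      Star.reverse id (wellFounded⇒reachable _≟V_ acyclic⇒noetherian successor z)

    acyclic∧reachesAll⇒source : ∀ {r} → (∀ z → Star (Arc D) r z) → IsSource r
    acyclic∧reachesAll⇒source {r} r⇝ = cong length
      (filter-none (λ w → arc? w r) (All.universal (λ w a → acyclic⇒no-return a (r⇝ w)) vertices))

    acyclic∧reachedByAll⇒sink : ∀ {s} → (∀ z → Star (Arc D) z s) → IsSink s
    acyclic∧reachedByAll⇒sink {s} ⇝s = cong length
      (filter-none (arc? s) (All.universal (λ w a → acyclic⇒no-return a (⇝s w)) vertices))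

  outTree⇒reachable : ∀ {r} → IsOutTree D r → ∀ z → Star (Arc D) r z
  outTree⇒reachable (tree , deg) = acyclic∧predecessors⇒reachable (orientedTree⇒acyclic tree)
    λ z z≢r → filter-some⁻ (λ w → arc? w z) vertices (≤-reflexive (sym (deg z z≢r)))

  inTree⇒coreachable : ∀ {s} → IsInTree D s → ∀ z → Star (Arc D) z s
  inTree⇒coreachable (tree , deg) = acyclic∧successors⇒coreachable (orientedTree⇒acyclic tree)
    λ z z≢s → filter-some⁻ (arc? z) vertices (≤-reflexive (sym (deg z z≢s)))

open SpanningSubdigraph using (digraph; subArc⊆)

outBranching⇒reachable : ∀ {D} → HasOutBranching D → ∃[ r ] (∀ z → Star (Arc D) r z)
outBranching⇒reachable (B , r , tree) =
  r , λ z → Star.map (subArc⊆ B) (outTree⇒reachable (digraph B) tree z)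

inBranching⇒coreachable : ∀ {D} → HasInBranching D → ∃[ s ] (∀ z → Star (Arc D) z s)
inBranching⇒coreachable (B , s , tree) =
  s , λ z → Star.map (subArc⊆ B) (inTree⇒coreachable (digraph B) tree z)

IsAcyclicBipolar : Digraph → Set
IsAcyclicBipolar R =
  Acyclic R ×
  (∃[ x ] ∃[ y ]
    (Digraph.IsSource R x × Digraph.IsSink R y ×
     (∀ z → Path (Arc R) x z × Path (Arc R) z y)))

HasAcyclicBipolarSpanning : Digraph → Set₁
HasAcyclicBipolarSpanning D =
  Σ[ S ∈ SpanningSubdigraph D ] IsAcyclicBipolar (digraph S)

acyclic∧neighbours⇒acyclicBipolar : ∀ R → Acyclic R → ∀ {r s} →
  (∀ z → z ≢ r → ∃[ w ] Arc R w z) → (∀ z → z ≢ s → ∃[ w ] Arc R z w) → IsAcyclicBipolar R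
acyclic∧neighbours⇒acyclicBipolar R acyclic {r} {s} predecessor successor =
  acyclic , r , s ,
  acyclic∧reachesAll⇒source R acyclic r⇝ , acyclic∧reachedByAll⇒sink R acyclic ⇝s ,
  λ z → star⇒path (Digraph._≟V_ R) (r⇝ z) , star⇒path (Digraph._≟V_ R) (⇝s z)
  where
  r⇝ : ∀ z → Star (Arc R) r z
  r⇝ = acyclic∧predecessors⇒reachable R acyclic predecessor
  ⇝s : ∀ z → Star (Arc R) z s
  ⇝s = acyclic∧successors⇒coreachable R acyclic successor

module _ (D : Digraph) {_≺_ : Rel (V D) 0ℓ} (_≺?_ : Decidable _≺_) where

  ascendingSubdigraph : SpanningSubdigraph D
  ascendingSubdigraph = record
    { SubArc  = λ u v → Arc D u v × u ≺ v
    ; subArc? = λ u v → Digraph.arc? D u v ×-dec u ≺? v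
    ; subArc⊆ = proj₁
    }

  ascendingDigraph : Digraph
  ascendingDigraph = digraph ascendingSubdigraph

  ascendingDigraph-acyclic : {_≈_ : Rel (V D) 0ℓ} → IsStrictPartialOrder _≈_ _≺_ →
    Acyclic ascendingDigraph
  ascendingDigraph-acyclic isSPO (_ , _ , (w , _) , _ , _ , y≺x) =
    ≺.irrefl ≺.Eq.refl (Star.gfoldl id _≺_ (λ y≺u (_ , u≺v) → ≺.trans y≺u u≺v) y≺x w)
    where module ≺ = IsStrictPartialOrder isSPO

module LayeredOrder {A : Set} {L : A → Set} (L? : Unary.Decidable L) (d₁ d₂ : A → ℕ) where

  level : A → ℕ ⊎ ℕ
  level z = if does (L? z) then inj₁ (d₁ z) else inj₂ (d₂ z)

  _≺_ : Rel A 0ℓ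
  _≺_ = (_<_ ⊎-< _>_) on level

  _≺?_ : Decidable _≺_
  _≺?_ = On.decidable level _ (⊎-<-decidable _<?_ _>?_)

  ≺-isStrictPartialOrder : IsStrictPartialOrder (Pointwise _≡_ _≡_ on level) _≺_
  ≺-isStrictPartialOrder = On.isStrictPartialOrder level
    (⊎-<-isStrictPartialOrder <-isStrictPartialOrder
      (Flip.isStrictPartialOrder <-isStrictPartialOrder))

  lower≺lower : ∀ {x y} → L x → L y → d₁ x < d₁ y → x ≺ y
  lower≺lower {x} {y} x∈L y∈L d< rewrite dec-true (L? x) x∈L | dec-true (L? y) y∈L = ₁∼₁ d<

  lower≺upper : ∀ {x y} → L x → ¬ L y → x ≺ y
  lower≺upper {x} {y} x∈L y∉L rewrite dec-true (L? x) x∈L | dec-false (L? y) y∉L = ₁∼₂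

  upper≺upper : ∀ {x y} → ¬ L x → ¬ L y → d₂ y < d₂ x → x ≺ y
  upper≺upper {x} {y} x∉L y∉L d< rewrite dec-false (L? x) x∉L | dec-false (L? y) y∉L = ₂∼₂ d<

layers⇒acyclicBipolarSpanning : (D : Digraph) {L : V D → Set} → Unary.Decidable L → ∀ r s →
  (∀ {z} → L z → Star (Arc D ↾ L) r z) →
  (∀ {z} → ¬ L z → Star (Arc D ↾ ∁ L) z s) →
  (∀ {z} → L z → ∃[ w ] (Arc D z w × ¬ L w)) →
  (∀ {z} → ¬ L z → ∃[ w ] (Arc D w z × L w)) →
  HasAcyclicBipolarSpanning D
layers⇒acyclicBipolarSpanning D {L} L? r s r⇝lower upper⇝s upper-successor lower-predecessor =
  ascendingSubdigraph D _≺?_ ,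
  acyclic∧neighbours⇒acyclicBipolar (ascendingDigraph D _≺?_)
    (ascendingDigraph-acyclic D _≺?_ ≺-isStrictPartialOrder) predecessor successor
  where
  open Digraph D using (arc?; enum)
  module FromR = Distance enum {flip (Arc D ↾ L)} (λ v u → arc? u v ×-dec L? u ×-dec L? v)
  module ToS   = Distance enum {Arc D ↾ ∁ L} (λ u v → arc? u v ×-dec ¬? (L? u) ×-dec ¬? (L? v))
  open LayeredOrder L? (λ z → FromR.distance z r) (λ z → ToS.distance z s)

  predecessor : ∀ z → z ≢ r → ∃[ w ] (Arc D w z × w ≺ z)
  predecessor z z≢r = case L? z of λ where
    (yes z∈L) →
      let w , (a , w∈L , _) , d< = FromR.distance-decreases (Star.reverse id (r⇝lower z∈L)) z≢r
      in w , a , lower≺lower w∈L z∈L d<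
    (no  z∉L) → let w , a , w∈L = lower-predecessor z∉L in w , a , lower≺upper w∈L z∉L

  successor : ∀ z → z ≢ s → ∃[ w ] (Arc D z w × z ≺ w)
  successor z z≢s = case L? z of λ where
    (yes z∈L) → let w , a , w∉L = upper-successor z∈L in w , a , lower≺upper z∈L w∉L
    (no  z∉L) →
      let w , (a , _ , w∉L) , d< = ToS.distance-decreases (upper⇝s z∉L) z≢s
      in w , a , upper≺upper z∉L w∉L d<

module _ (T : Digraph) (H : V T → Digraph) where

  private
    Q : Digraph
    Q = composition T H

  open Composition T H using (inner; outer)

  project-walk : ∀ {x y} → Star (Arc Q) x y → Star (Arc T) (proj₁ x) (proj₁ y)
  project-walk ε             = ε
  project-walk (inner _ ◅ w) = project-walk w
  project-walk (outer a ◅ w) = a ◅ project-walk w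

  module _ (h : ∀ i → V (H i)) where

    lift-walk : ∀ {i k j} → Arc T i k → Star (Arc T) k j → ∀ u v → Star (Arc Q) (i , u) (j , v)
    lift-walk a ε       u v = outer a ◅ ε
    lift-walk a (b ◅ w) u v = outer a ◅ lift-walk b w (h _) v

    composition-strong⁺ : 2 ≤ order T → Strong T → Strong Q
    composition-strong⁺ 2≤∣T∣ T-strong = walks⇒strong Q λ (i , u) (j , v) →
      let k , a = strong⇒successor T 2≤∣T∣ T-strong i in lift-walk a (proj₁ (T-strong k j)) u v

    composition-strong⁻ : Strong Q → Strong T
    composition-strong⁻ Q-strong = walks⇒strong T λ i j →
      project-walk (proj₁ (Q-strong (i , h i) (j , h j)))

  nonstrong⇒acyclicBipolarSpanning : 2 ≤ order T → (∀ i → V (H i)) → Semicomplete T → ¬ Strong Q →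
    ∃[ r ] (∀ z → Star (Arc Q) r z) → ∃[ s ] (∀ z → Star (Arc Q) z s) → HasAcyclicBipolarSpanning Q
  nonstrong⇒acyclicBipolarSpanning 2≤∣T∣ h semicomplete ¬strong (r@(p , _) , r⇝) (s@(q , _) , ⇝s) =
    layers⇒acyclicBipolarSpanning Q {L} (λ (i , _) → star? i p) r s
      (λ z∈L → walk-within-predecessor-closed L-closed z∈L (r⇝ _))
      (λ z∉L → walk-within-successor-closed (contraposition ∘ L-closed) z∉L (⇝s _))
      (λ z∈L → s , outer (dominates-q z∈L) , q↛p)
      (λ z∉L → r , outer (dominated-by-p z∉L) , ε)
    where
    open Distance (Digraph.enum T) (Digraph.arc? T) using (star?)

    L : V Q → Set
    L (i , _) = Star (Arc T) i p

    L-closed : ∀ {z w} → Arc Q z w → L w → L z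
    L-closed a w∈L = project-walk (a ◅ ε) ◅◅ w∈L

    q↛p : ¬ Star (Arc T) q p
    q↛p q⇝p = ¬strong (composition-strong⁺ h 2≤∣T∣ (walks⇒strong T λ i j →
      project-walk (⇝s (i , h i)) ◅◅ q⇝p ◅◅ project-walk (r⇝ (j , h j))))

    dominates-q : ∀ {i} → Star (Arc T) i p → Arc T i q
    dominates-q {i} i⇝p with semicomplete i q (λ { refl → q↛p i⇝p })
    ... | inj₁ a = a
    ... | inj₂ a = contradiction (a ◅ i⇝p) q↛p

    dominated-by-p : ∀ {i} → ¬ Star (Arc T) i p → Arc T p i
    dominated-by-p {i} i↛p with semicomplete p i (λ { refl → i↛p ε })
    ... | inj₁ a = a
    ... | inj₂ a = contradiction (a ◅ ε) i↛p

  strong⇒acyclicBipolarSpanning : 2 ≤ order T → Strong T → (∀ i → 2 ≤ order (H i)) →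
    HasAcyclicBipolarSpanning Q
  strong⇒acyclicBipolarSpanning 2≤∣T∣ T-strong 2≤∣H∣ =
    layers⇒acyclicBipolarSpanning Q {L} (λ (i , v) → Digraph._≟V_ (H i) v (a i)) (p , a p) (p , b p)
      r⇝lower upper⇝s
      (λ {z} _ → let j , e = successor (proj₁ z) in (j , b j) , outer e , b≢a j)
      (λ {z} _ → let j , e = predecessor (proj₁ z) in (j , a j) , outer e , refl)
    where
    p : V T
    p = element (Digraph.enum T) (<⇒≤ 2≤∣T∣)

    a b : ∀ i → V (H i)
    a i = element (Digraph.enum (H i)) (<⇒≤ (2≤∣H∣ i))
    b i = proj₁ (another-element (Digraph.enum (H i)) (2≤∣H∣ i) (a i))

    b≢a : ∀ i → b i ≢ a i
    b≢a i = ≢-sym (proj₂ (another-element (Digraph.enum (H i)) (2≤∣H∣ i) (a i)))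

    L : V Q → Set
    L (i , v) = v ≡ a i

    successor : ∀ i → ∃[ j ] Arc T i j
    successor = strong⇒successor T 2≤∣T∣ T-strong

    predecessor : ∀ i → ∃[ j ] Arc T j i
    predecessor = strong⇒predecessor T 2≤∣T∣ T-strong

    r⇝lower : ∀ {z} → L z → Star (Arc Q ↾ L) (p , a p) z
    r⇝lower {i , _} refl =
      Star.gmap (λ j → j , a j) (λ e → outer e , refl , refl) (proj₁ (T-strong p i))

    upper⇝s : ∀ {z} → ¬ L z → Star (Arc Q ↾ ∁ L) z (p , b p)
    upper⇝s {i , _} z∉L = let j , e = successor i in
      (outer e , z∉L , b≢a j) ◅
      Star.gmap (λ k → k , b k) (λ e′ → outer e′ , b≢a _ , b≢a _) (proj₁ (T-strong j p))

theorem6p2 : (T : Digraph) (H : V T → Digraph) →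
    2 ≤ order T →
    (∀ i → 1 ≤ order (H i)) →
    Semicomplete T →
    let Q = composition T H in
    (¬ Strong Q × HasInBranching Q × HasOutBranching Q) ⊎ (Strong Q × (∀ i → 2 ≤ order (H i))) →
    Σ[ S ∈ SpanningSubdigraph Q ]
      let R = SpanningSubdigraph.digraph S in
      Acyclic R ×
      (∃[ x ] ∃[ y ]
        (Digraph.IsSource R x × Digraph.IsSink R y ×
         (∀ (z : V Q) → Path (Arc R) x z × Path (Arc R) z y)))
theorem6p2 T H 2≤∣T∣ 1≤∣H∣ semicomplete (inj₁ (¬strong , B⁻ , B⁺)) =
  nonstrong⇒acyclicBipolarSpanning T H 2≤∣T∣ (λ i → element (Digraph.enum (H i)) (1≤∣H∣ i))
    semicomplete ¬strong (outBranching⇒reachable B⁺) (inBranching⇒coreachable B⁻)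
theorem6p2 T H 2≤∣T∣ 1≤∣H∣ _ (inj₂ (Q-strong , 2≤∣H∣)) =
  strong⇒acyclicBipolarSpanning T H 2≤∣T∣
    (composition-strong⁻ T H (λ i → element (Digraph.enum (H i)) (1≤∣H∣ i)) Q-strong) 2≤∣H∣
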